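{- Let $H$ be a connected graph with $k=|V(H)|>1$ vertices that does not contain two true twins or does not contain two false twins. Then for every $p\in[0,1)$ there is no deterministic algorithm solving the Delayed Connected $H$-Node-Deletion Problem with predictions that has both consistency less than $k-\frac{1}{2-p}(k-1)$ and robustness less than $k+\frac{p}{1-p}$.
   Context: All graphs are finite, simple and undirected. Two distinct vertices are false twins if they have the same open neighborhood, and true twins if they have the same closed neighborhood $N[v]=N(v)\cup\{v\}$. An induced copy of $H$ in $G$ is an induced subgraph isomorphic to $H$; $G$ is $H$-free if it has none. An online graph $G$ has vertices $v_1,\dots,v_n$ revealed one at a time; $G_t=G[\{v_1,\dots,v_t\}]$. Delayed Connected $H$-Node-Deletion Problem with predictions (fixed connected $H$): when $v_t$ is revealed the algorithm receives a bit $u_t(G)\in\{0,1\}$; it must choose sets $S_1\subseteq\dots\subseteq S_n$ with $S_t\subseteq V(G_t)$ and $G_t-S_t$ $H$-free for each $t$, where $S_t$ depends only on $G_t$ and $u_1(G),\dots,u_t(G)$; the cost is $|S_n|$. $\mathrm{OPT}(G)$ is the minimum size of $S\subseteq V(G)$ with $G-S$ $H$-free. The advice is correct if the set of vertices with bit $1$ is a minimum-size such set. An algorithm is $(r,w)$-competitive if there is a constant $\alpha\ge0$ such that for every online graph $G$: for some correct advice its cost is at most $r\cdot\mathrm{OPT}(G)+\alpha$, and for every advice (correct or not) its cost is at most $w\cdot\mathrm{OPT}(G)+\alpha$. Consistency (resp. robustness) is the infimum of such $r$ (resp. $w$). -}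

module Defs where

open import Data.Bool using (Bool)
open import Data.Empty using (⊥)
open import Data.Fin using (Fin; zero; suc)
open import Data.Fin.Subset using (Subset; _∈_; _∉_; ∣_∣)
open import Data.Fin.Subset.Properties using (_∈?_)
import Data.Integer as ℤ
open import Data.Nat using (ℕ; zero; suc)
import Data.Nat as ℕ
import Data.Nat.Properties as ℕ
open import Data.Product using (Σ-syntax; ∃; ∃-syntax; _×_; _,_; proj₁; proj₂)
open import Data.Rational using (ℚ; 0ℚ; 1ℚ; ½)
import Data.Rational as ℚ
import Data.Rational.Properties as ℚ
open import Data.Rational.Solver using (module +-*-Solver)
open import Data.Refinement using (Refinement-syntax; value)
open import Data.Sum using (_⊎_)
open import Data.Vec using ([]; _∷_)
open import Function using (_⇔_)
open import Function.Definitions using (Injective)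
open import Level using (0ℓ)
open import Relation.Binary using (Rel; Symmetric; Decidable)
open import Relation.Binary.Construct.Closure.ReflexiveTransitive using (Star)
open import Relation.Binary.PropositionalEquality
open import Relation.Nullary using (¬_; yes; no; contradiction)
open import Relation.Unary using (Pred)

private
  variable
    n t k : ℕ
    V W : Set

IsCauchy : (ℕ → ℚ) → Set
IsCauchy s = ∀ ε → 0ℚ ℚ.< ε →
  ∃[ N ] ∀ i j → N ℕ.≤ i → N ℕ.≤ j → ℚ.∣ s i ℚ.- s j ∣ ℚ.< ε

record ℝ : Set where
  constructor mkℝ
  field
    seq    : ℕ → ℚ
    cauchy : IsCauchy seq

open ℝ public

infix  4 _<_ _≤_
infixl 6 _+_ _-_
infixl 7 _*_

-- Reals are not quotiented: Cauchy sequences with the same limit are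
-- indistinguishable for _<_ and _≤_.
_<_ : Rel ℝ 0ℓ
x < y = ∃[ ε ] 0ℚ ℚ.< ε × ∃[ N ] ∀ i → N ℕ.≤ i → seq x i ℚ.+ ε ℚ.≤ seq y i

_≤_ : Rel ℝ 0ℓ
x ≤ y = ¬ (y < x)

fromℚ : ℚ → ℝ
fromℚ q = mkℝ (λ _ → q) λ ε 0<ε → 0 , λ _ _ _ _ →
  subst (ℚ._< ε) (sym (cong ℚ.∣_∣ (ℚ.+-inverseʳ q))) 0<ε

fromℕ : ℕ → ℝ
fromℕ m = fromℚ (ℤ.+ m ℚ./ 1)

0ℝ 1ℝ 2ℝ : ℝ
0ℝ = fromℕ 0
1ℝ = fromℕ 1
2ℝ = fromℕ 2

private
  open +-*-Solver using (solve; con; _:+_; _:*_; _:-_; :-_; _:=_)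

  half-pos : ∀ {ε} → 0ℚ ℚ.< ε → 0ℚ ℚ.< ½ ℚ.* ε
  half-pos {ε} 0<ε = subst (ℚ._< ½ ℚ.* ε) (ℚ.*-zeroʳ ½) (ℚ.*-monoʳ-<-pos ½ 0<ε)

  half+half : ∀ ε → ½ ℚ.* ε ℚ.+ ½ ℚ.* ε ≡ ε
  half+half = solve 1 (λ e → con ½ :* e :+ con ½ :* e := e) refl

  +-cauchy : ∀ {s s′} → IsCauchy s → IsCauchy s′ → IsCauchy (λ i → s i ℚ.+ s′ i)
  +-cauchy {s} {s′} cs cs′ ε 0<ε
    with N , h ← cs (½ ℚ.* ε) (half-pos 0<ε)
       | N′ , h′ ← cs′ (½ ℚ.* ε) (half-pos 0<ε)
    = N ℕ.⊔ N′ , λ i j Ni Nj → begin-strict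
        ℚ.∣ (s i ℚ.+ s′ i) ℚ.- (s j ℚ.+ s′ j) ∣
          ≡⟨ cong ℚ.∣_∣ (solve 4 (λ a b c d → (a :+ b) :- (c :+ d) := (a :- c) :+ (b :- d))
                          refl (s i) (s′ i) (s j) (s′ j)) ⟩
        ℚ.∣ (s i ℚ.- s j) ℚ.+ (s′ i ℚ.- s′ j) ∣
          ≤⟨ ℚ.∣p+q∣≤∣p∣+∣q∣ (s i ℚ.- s j) (s′ i ℚ.- s′ j) ⟩
        ℚ.∣ s i ℚ.- s j ∣ ℚ.+ ℚ.∣ s′ i ℚ.- s′ j ∣
          <⟨ ℚ.+-mono-< (h i j (ℕ.m⊔n≤o⇒m≤o N N′ Ni) (ℕ.m⊔n≤o⇒m≤o N N′ Nj))
                        (h′ i j (ℕ.m⊔n≤o⇒n≤o N N′ Ni) (ℕ.m⊔n≤o⇒n≤o N N′ Nj)) ⟩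
        ½ ℚ.* ε ℚ.+ ½ ℚ.* ε ≡⟨ half+half ε ⟩
        ε ∎
    where open ℚ.≤-Reasoning

  neg-cauchy : ∀ {s} → IsCauchy s → IsCauchy (λ i → ℚ.- s i)
  neg-cauchy {s} cs ε 0<ε with N , h ← cs ε 0<ε
    = N , λ i j Ni Nj → subst (ℚ._< ε) (lem (s i) (s j)) (h i j Ni Nj)
    where
    lem : ∀ a b → ℚ.∣ a ℚ.- b ∣ ≡ ℚ.∣ (ℚ.- a) ℚ.- (ℚ.- b) ∣
    lem a b = trans (sym (ℚ.∣-p∣≡∣p∣ (a ℚ.- b)))
      (cong ℚ.∣_∣ (solve 2 (λ x y → :- (x :- y) := (:- x) :- (:- y)) refl a b))

_+_ : ℝ → ℝ → ℝ
x + y = mkℝ (λ i → seq x i ℚ.+ seq y i) (+-cauchy {seq x} {seq y} (cauchy x) (cauchy y))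

-_ : ℝ → ℝ
- x = mkℝ (λ i → ℚ.- seq x i) (neg-cauchy {seq x} (cauchy x))

_-_ : ℝ → ℝ → ℝ
x - y = x + (- y)

-- 1/q, extended by 1/0 = 0
recip : ℚ → ℚ
recip q with q ℚ.≟ 0ℚ
... | yes _   = 0ℚ
... | no q≢0 = (ℚ.1/ q) {{ℚ.≢-nonZero q≢0}}

recip-inverse : ∀ {q} → 0ℚ ℚ.< q → recip q ℚ.* q ≡ 1ℚ
recip-inverse {q} 0<q with q ℚ.≟ 0ℚ
... | yes q≡0 = contradiction (sym q≡0) (ℚ.<⇒≢ 0<q)
... | no q≢0  = ℚ.*-inverseˡ q {{ℚ.≢-nonZero q≢0}}

private
  0≤∣_∣ : ∀ q → 0ℚ ℚ.≤ ℚ.∣ q ∣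
  0≤∣ q ∣ = ℚ.0≤∣p∣ q

  *-pos : ∀ {a b} → 0ℚ ℚ.< a → 0ℚ ℚ.< b → 0ℚ ℚ.< a ℚ.* b
  *-pos {a} {b} 0<a 0<b =
    subst (ℚ._< a ℚ.* b) (ℚ.*-zeroʳ a) (ℚ.*-monoʳ-<-pos a {{ℚ.positive 0<a}} 0<b)

  recip-pos : ∀ {q} → 0ℚ ℚ.< q → 0ℚ ℚ.< recip q
  recip-pos {q} 0<q = ℚ.*-cancelʳ-<-nonNeg q {{ℚ.nonNegative (ℚ.<⇒≤ 0<q)}}
    (subst₂ ℚ._<_ (sym (ℚ.*-zeroˡ q)) (sym (recip-inverse 0<q)) (ℚ.positive⁻¹ 1ℚ))

  *-mono-≤ : ∀ {a b c d} → 0ℚ ℚ.≤ b → 0ℚ ℚ.≤ c → a ℚ.≤ b → c ℚ.≤ d →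
             a ℚ.* c ℚ.≤ b ℚ.* d
  *-mono-≤ {a} {b} {c} {d} 0≤b 0≤c a≤b c≤d = ℚ.≤-trans
    (ℚ.*-monoʳ-≤-nonNeg c {{ℚ.nonNegative 0≤c}} a≤b)
    (ℚ.*-monoˡ-≤-nonNeg b {{ℚ.nonNegative 0≤b}} c≤d)

  Bound : (ℕ → ℚ) → Set
  Bound s = ∃[ B ] 0ℚ ℚ.< B × ∃[ N ] ∀ i → N ℕ.≤ i → ℚ.∣ s i ∣ ℚ.≤ B

  bounded : ∀ {s} → IsCauchy s → Bound s
  bounded {s} cs with N , h ← cs 1ℚ (ℚ.positive⁻¹ 1ℚ)
    = 1ℚ ℚ.+ ℚ.∣ s N ∣
    , ℚ.<-≤-trans (ℚ.positive⁻¹ 1ℚ)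
        (subst (ℚ._≤ 1ℚ ℚ.+ ℚ.∣ s N ∣) (ℚ.+-identityʳ 1ℚ) (ℚ.+-monoʳ-≤ 1ℚ 0≤∣ s N ∣))
    , N , λ i Ni → begin
        ℚ.∣ s i ∣ ≡⟨ cong ℚ.∣_∣ (solve 2 (λ a b → a := (a :- b) :+ b) refl (s i) (s N)) ⟩
        ℚ.∣ (s i ℚ.- s N) ℚ.+ s N ∣ ≤⟨ ℚ.∣p+q∣≤∣p∣+∣q∣ (s i ℚ.- s N) (s N) ⟩
        ℚ.∣ s i ℚ.- s N ∣ ℚ.+ ℚ.∣ s N ∣
          ≤⟨ ℚ.+-monoˡ-≤ ℚ.∣ s N ∣ (ℚ.<⇒≤ (h i N Ni ℕ.≤-refl)) ⟩
        1ℚ ℚ.+ ℚ.∣ s N ∣ ∎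
    where open ℚ.≤-Reasoning

  *-difference : ∀ x y x′ y′ →
    x ℚ.* y ℚ.- x′ ℚ.* y′ ≡ (y ℚ.- y′) ℚ.* x ℚ.+ (x ℚ.- x′) ℚ.* y′
  *-difference = solve 4 (λ x y x′ y′ → x :* y :- x′ :* y′
                                 := (y :- y′) :* x :+ (x :- x′) :* y′) refl

  recip-difference : ∀ a b u v →
    (u ℚ.- v) ℚ.* (a ℚ.* b) ≡ (u ℚ.* a) ℚ.* b ℚ.- (v ℚ.* b) ℚ.* a
  recip-difference = solve 4 (λ a b u v → (u :- v) :* (a :* b)
                                     := (u :* a) :* b :- (v :* b) :* a) refl

  *-small : ∀ {C η} d e → 0ℚ ℚ.< C → ℚ.∣ d ∣ ℚ.< η ℚ.* recip C → ℚ.∣ e ∣ ℚ.≤ C →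
            ℚ.∣ d ℚ.* e ∣ ℚ.< η
  *-small {C} {η} d e 0<C d< e≤ = begin-strict
    ℚ.∣ d ℚ.* e ∣ ≡⟨ ℚ.∣p*q∣≡∣p∣*∣q∣ d e ⟩
    ℚ.∣ d ∣ ℚ.* ℚ.∣ e ∣ ≤⟨ ℚ.*-monoˡ-≤-nonNeg ℚ.∣ d ∣ {{ℚ.nonNegative 0≤∣ d ∣}} e≤ ⟩
    ℚ.∣ d ∣ ℚ.* C <⟨ ℚ.*-monoˡ-<-pos C {{ℚ.positive 0<C}} d< ⟩
    η ℚ.* recip C ℚ.* C ≡⟨ ℚ.*-assoc η (recip C) C ⟩
    η ℚ.* (recip C ℚ.* C) ≡⟨ cong (η ℚ.*_) (recip-inverse 0<C) ⟩
    η ℚ.* 1ℚ ≡⟨ ℚ.*-identityʳ η ⟩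
    η ∎
    where open ℚ.≤-Reasoning

  *-close : ∀ {B B′ η} x y x′ y′ → 0ℚ ℚ.< B → 0ℚ ℚ.< B′ →
            ℚ.∣ x ∣ ℚ.≤ B → ℚ.∣ y′ ∣ ℚ.≤ B′ →
            ℚ.∣ x ℚ.- x′ ∣ ℚ.< η ℚ.* recip B′ → ℚ.∣ y ℚ.- y′ ∣ ℚ.< η ℚ.* recip B →
            ℚ.∣ x ℚ.* y ℚ.- x′ ℚ.* y′ ∣ ℚ.< η ℚ.+ η
  *-close {B} {B′} {η} x y x′ y′ 0<B 0<B′ bx by dx dy = begin-strict
    ℚ.∣ x ℚ.* y ℚ.- x′ ℚ.* y′ ∣
      ≡⟨ cong ℚ.∣_∣ (*-difference x y x′ y′) ⟩
    ℚ.∣ (y ℚ.- y′) ℚ.* x ℚ.+ (x ℚ.- x′) ℚ.* y′ ∣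
      ≤⟨ ℚ.∣p+q∣≤∣p∣+∣q∣ ((y ℚ.- y′) ℚ.* x) ((x ℚ.- x′) ℚ.* y′) ⟩
    ℚ.∣ (y ℚ.- y′) ℚ.* x ∣ ℚ.+ ℚ.∣ (x ℚ.- x′) ℚ.* y′ ∣
      <⟨ ℚ.+-mono-< (*-small {B} {η} (y ℚ.- y′) x 0<B dy bx)
                    (*-small {B′} {η} (x ℚ.- x′) y′ 0<B′ dx by) ⟩
    η ℚ.+ η ∎
    where open ℚ.≤-Reasoning

  *-cauchy : ∀ {s s′} → IsCauchy s → IsCauchy s′ → IsCauchy (λ i → s i ℚ.* s′ i)
  *-cauchy {s} {s′} cs cs′ ε 0<ε =
    let B , 0<B , M , b = bounded cs
        B′ , 0<B′ , M′ , b′ = bounded cs′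
        N , h = cs (½ ℚ.* ε ℚ.* recip B′) (*-pos (half-pos 0<ε) (recip-pos 0<B′))
        N′ , h′ = cs′ (½ ℚ.* ε ℚ.* recip B) (*-pos (half-pos 0<ε) (recip-pos 0<B))
    in (M ℕ.⊔ M′) ℕ.⊔ (N ℕ.⊔ N′) , λ i j Ki Kj →
      let Mi = ℕ.m⊔n≤o⇒m≤o (M ℕ.⊔ M′) (N ℕ.⊔ N′) Ki
          Ni = ℕ.m⊔n≤o⇒n≤o (M ℕ.⊔ M′) (N ℕ.⊔ N′) Ki
          Mj = ℕ.m⊔n≤o⇒m≤o (M ℕ.⊔ M′) (N ℕ.⊔ N′) Kj
          Nj = ℕ.m⊔n≤o⇒n≤o (M ℕ.⊔ M′) (N ℕ.⊔ N′) Kj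
      in subst (ℚ.∣ s i ℚ.* s′ i ℚ.- s j ℚ.* s′ j ∣ ℚ.<_) (half+half ε)
           (*-close {B} {B′} {½ ℚ.* ε} (s i) (s′ i) (s j) (s′ j) 0<B 0<B′
             (b i (ℕ.m⊔n≤o⇒m≤o M M′ Mi)) (b′ j (ℕ.m⊔n≤o⇒n≤o M M′ Mj))
             (h i j (ℕ.m⊔n≤o⇒m≤o N N′ Ni) (ℕ.m⊔n≤o⇒m≤o N N′ Nj))
             (h′ i j (ℕ.m⊔n≤o⇒n≤o N N′ Ni) (ℕ.m⊔n≤o⇒n≤o N N′ Nj)))

  recip-cauchy : ∀ {s} → IsCauchy s →
                 ∀ {c} → 0ℚ ℚ.< c → ∀ {M} → (∀ i → M ℕ.≤ i → c ℚ.≤ s i) →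
                 IsCauchy (λ i → recip (s i))
  recip-cauchy {s} cs {c} 0<c {M} c≤ ε 0<ε
    with N , h ← cs (ε ℚ.* (c ℚ.* c)) (*-pos 0<ε (*-pos 0<c 0<c))
    = M ℕ.⊔ N , λ i j Ki Kj →
        close (c≤ i (ℕ.m⊔n≤o⇒m≤o M N Ki)) (c≤ j (ℕ.m⊔n≤o⇒m≤o M N Kj))
              (h i j (ℕ.m⊔n≤o⇒n≤o M N Ki) (ℕ.m⊔n≤o⇒n≤o M N Kj))
    where
    open ℚ.≤-Reasoning
    close : ∀ {a b} → c ℚ.≤ a → c ℚ.≤ b → ℚ.∣ a ℚ.- b ∣ ℚ.< ε ℚ.* (c ℚ.* c) →
            ℚ.∣ recip a ℚ.- recip b ∣ ℚ.< ε
    close {a} {b} c≤a c≤b d< =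
      ℚ.*-cancelʳ-<-nonNeg (c ℚ.* c) {{ℚ.nonNegative (ℚ.<⇒≤ (*-pos 0<c 0<c))}}
        (begin-strict
          ℚ.∣ ra ℚ.- rb ∣ ℚ.* (c ℚ.* c)
            ≤⟨ ℚ.*-monoˡ-≤-nonNeg ℚ.∣ ra ℚ.- rb ∣ {{ℚ.nonNegative 0≤∣ ra ℚ.- rb ∣}}
                 (*-mono-≤ (ℚ.<⇒≤ 0<a) (ℚ.<⇒≤ 0<c) c≤a c≤b) ⟩
          ℚ.∣ ra ℚ.- rb ∣ ℚ.* (a ℚ.* b)
            ≡⟨ cong (ℚ.∣ ra ℚ.- rb ∣ ℚ.*_)
                 (sym (ℚ.0≤p⇒∣p∣≡p (ℚ.<⇒≤ (*-pos 0<a 0<b)))) ⟩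
          ℚ.∣ ra ℚ.- rb ∣ ℚ.* ℚ.∣ a ℚ.* b ∣
            ≡⟨ sym (ℚ.∣p*q∣≡∣p∣*∣q∣ (ra ℚ.- rb) (a ℚ.* b)) ⟩
          ℚ.∣ (ra ℚ.- rb) ℚ.* (a ℚ.* b) ∣
            ≡⟨ cong ℚ.∣_∣ (recip-difference a b ra rb) ⟩
          ℚ.∣ (ra ℚ.* a) ℚ.* b ℚ.- (rb ℚ.* b) ℚ.* a ∣
            ≡⟨ cong₂ (λ u v → ℚ.∣ u ℚ.* b ℚ.- v ℚ.* a ∣)
                 (recip-inverse 0<a) (recip-inverse 0<b) ⟩
          ℚ.∣ 1ℚ ℚ.* b ℚ.- 1ℚ ℚ.* a ∣
            ≡⟨ cong ℚ.∣_∣ (solve 2 (λ x y → con 1ℚ :* y :- con 1ℚ :* x := :- (x :- y))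
                            refl a b) ⟩
          ℚ.∣ ℚ.- (a ℚ.- b) ∣ ≡⟨ ℚ.∣-p∣≡∣p∣ (a ℚ.- b) ⟩
          ℚ.∣ a ℚ.- b ∣ <⟨ d< ⟩
          ε ℚ.* (c ℚ.* c) ∎)
      where
      ra = recip a
      rb = recip b
      0<a = ℚ.<-≤-trans 0<c c≤a
      0<b = ℚ.<-≤-trans 0<c c≤b

_*_ : ℝ → ℝ → ℝ
x * y = mkℝ (λ i → seq x i ℚ.* seq y i) (*-cauchy {seq x} {seq y} (cauchy x) (cauchy y))

-- The term-by-term reciprocal; positivity of x keeps the terms eventually
-- bounded away from 0, so the value 1/0 = 0 affects finitely many terms only.
1/_[_] : (x : ℝ) → 0ℝ < x → ℝ
1/ x [ 0<x ] = mkℝ (λ i → recip (seq x i))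
  (let ε , 0<ε , N , h = 0<x in
   recip-cauchy {seq x} (cauchy x) 0<ε {N}
     λ i Ni → subst (ℚ._≤ seq x i) (ℚ.+-identityˡ ε) (h i Ni))

x<y⇒0<y-x : ∀ {x y} → x < y → 0ℝ < y - x
x<y⇒0<y-x {x} {y} (ε , 0<ε , N , h) = ε , 0<ε , N , λ i Ni →
  subst (ℚ._≤ seq y i ℚ.- seq x i)
    (solve 2 (λ a e → (a :+ e) :- a := con 0ℚ :+ e) refl (seq x i) ε)
    (ℚ.+-monoˡ-≤ (ℚ.- seq x i) (h i Ni))

x<1⇒x<2 : ∀ {x} → x < 1ℝ → x < 2ℝ
x<1⇒x<2 (ε , 0<ε , N , h) = ε , 0<ε , N , λ i Ni →
  ℚ.≤-trans (h i Ni) (ℚ.*≤* (ℤ.+≤+ (ℕ.s≤s ℕ.z≤n)))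

-- An upper real x ∈ ℝ ∪ {±∞} is given by the set {a : x < a}.
UpperReal : Set₁
UpperReal = Pred ℝ 0ℓ

-- inf P < a holds iff some element of P is strictly below a.  As an upper
-- real the infimum exists for every P, including the empty set (inf ∅ = +∞).
inf : Pred ℝ 0ℓ → UpperReal
inf P a = ∃[ r ] P r × r < a

infix 4 _<ᵘ_
_<ᵘ_ : UpperReal → ℝ → Set
x <ᵘ a = x a

record Graph (V : Set) : Set₁ where
  field
    Adj         : Rel V 0ℓ
    symmetric   : Symmetric Adj
    irreflexive : ∀ {v} → ¬ Adj v v
    adj?        : Decidable Adj

open Graph public using (Adj)

Connected : Graph V → Set
Connected G = ∀ u v → Star (Adj G) u v

FalseTwins : (G : Graph V) → Rel V 0ℓ
FalseTwins G u v = u ≢ v × (∀ w → Adj G u w ⇔ Adj G v w)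

TrueTwins : (G : Graph V) → Rel V 0ℓ
TrueTwins G u v = u ≢ v × (∀ w → (w ≡ u ⊎ Adj G u w) ⇔ (w ≡ v ⊎ Adj G v w))

record InducedCopy (H : Graph V) (G : Graph W) : Set where
  field
    embed     : V → W
    injective : Injective _≡_ _≡_ embed
    induced   : ∀ u v → Adj H u v ⇔ Adj G (embed u) (embed v)

_FreeOf_ : Graph W → Graph V → Set
G FreeOf H = ¬ InducedCopy H G

infixl 6 _∖_
_∖_ : Graph (Fin n) → (X : Subset n) → Graph [ v ∈ Fin n ∣ v ∉ X ]
G ∖ X = record
  { Adj         = λ u v → Adj G (value u) (value v)
  ; symmetric   = Graph.symmetric G
  ; irreflexive = Graph.irreflexive G
  ; adj?        = λ u v → Graph.adj? G (value u) (value v)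
  }

DeletionSet : Graph (Fin k) → Graph (Fin n) → Subset n → Set
DeletionSet H G X = (G ∖ X) FreeOf H

MinimumDeletionSet : Graph (Fin k) → Graph (Fin n) → Subset n → Set
MinimumDeletionSet H G X =
  DeletionSet H G X × (∀ Y → DeletionSet H G Y → ∣ X ∣ ℕ.≤ ∣ Y ∣)

-- OPT(G) = m, as a relation.
IsOPT : Graph (Fin k) → Graph (Fin n) → ℕ → Set
IsOPT H G m = ∃[ X ] MinimumDeletionSet H G X × ∣ X ∣ ≡ m

-- G ▷ N is G followed by a new vertex whose set of neighbours among the
-- vertices of G is N.  The newest vertex is zero and the earlier ones are
-- shifted by suc, so G is the graph G_t revealed just before the last step.
infixl 5 _▷_
data OnlineGraph : ℕ → Set where
  ∅   : OnlineGraph 0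
  _▷_ : OnlineGraph t → Subset t → OnlineGraph (suc t)

OnlineAdj : OnlineGraph n → Rel (Fin n) 0ℓ
OnlineAdj (G ▷ N) zero    zero    = ⊥
OnlineAdj (G ▷ N) zero    (suc v) = v ∈ N
OnlineAdj (G ▷ N) (suc u) zero    = u ∈ N
OnlineAdj (G ▷ N) (suc u) (suc v) = OnlineAdj G u v

private
  online-sym : (G : OnlineGraph n) → ∀ u v → OnlineAdj G u v → OnlineAdj G v u
  online-sym (G ▷ N) zero    (suc v) e = e
  online-sym (G ▷ N) (suc u) zero    e = e
  online-sym (G ▷ N) (suc u) (suc v) e = online-sym G u v e

  online-irrefl : (G : OnlineGraph n) → ∀ v → ¬ OnlineAdj G v v
  online-irrefl (G ▷ N) (suc v) e = online-irrefl G v e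

  online-adj? : (G : OnlineGraph n) → Decidable (OnlineAdj G)
  online-adj? (G ▷ N) zero    zero    = no λ ()
  online-adj? (G ▷ N) zero    (suc v) = v ∈? N
  online-adj? (G ▷ N) (suc u) zero    = u ∈? N
  online-adj? (G ▷ N) (suc u) (suc v) = online-adj? G u v

⟦_⟧ : OnlineGraph n → Graph (Fin n)
⟦ G ⟧ = record
  { Adj         = OnlineAdj G
  ; symmetric   = λ {u} {v} → online-sym G u v
  ; irreflexive = λ {v} → online-irrefl G v
  ; adj?        = online-adj? G
  }

-- The bits received so far, newest first: equivalently, the set of vertices
-- with bit 1.
Advice : ℕ → Set
Advice = Subset

record Algorithm (H : Graph (Fin k)) : Set where
  field
    deleted    : OnlineGraph t → Advice t → Subset t
    increasing : (G : OnlineGraph t) (N : Subset t) (u : Advice t) (b : Bool) →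
                 ∀ {v} → v ∈ deleted G u → suc v ∈ deleted (G ▷ N) (b ∷ u)
    solves     : (G : OnlineGraph t) (u : Advice t) →
                 DeletionSet H ⟦ G ⟧ (deleted G u)

module _ {H : Graph (Fin k)} (A : Algorithm H) where

  open Algorithm A

  cost : OnlineGraph n → Advice n → ℕ
  cost G u = ∣ deleted G u ∣

  CostBound : OnlineGraph n → Advice n → (c α : ℝ) → Set
  CostBound G u c α =
    ∀ m → IsOPT H ⟦ G ⟧ m → fromℕ (cost G u) ≤ c * fromℕ m + α

  Competitive : (r w : ℝ) → Set
  Competitive r w = ∃[ α ] 0ℝ ≤ α ×
    (∀ {n} (G : OnlineGraph n) →
      (∃[ u ] MinimumDeletionSet H ⟦ G ⟧ u × CostBound G u r α) ×
      (∀ u → CostBound G u w α))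

  consistency : UpperReal
  consistency = inf λ r → ∃[ w ] Competitive r w

  robustness : UpperReal
  robustness = inf λ w → ∃[ r ] Competitive r w

{-# OPTIONS --safe #-}
-- Colour vertices by V(H), join differently coloured ones as in H, and make
-- equally coloured ones twins of a kind (true or false) that H does not have.
-- An induced copy of H then has one vertex of every colour, so the deletion
-- sets are the sets containing a whole colour class, and OPT is the size m of
-- the smallest class.
--
-- The adversary always predicts the class of colour zero and adds a vertex to
-- a class that is entirely deleted; such a class exists because the remaining
-- graph is H-free.  At most one vertex per class is ever kept, so after n steps
-- the cost t is at least n - k.  Robustness gives t ≤ w m + α.  Enlarging all
-- other classes makes class zero, of size c, the unique optimum without
-- lowering the cost, so consistency gives t ≤ r c + α.  With D = 1 - p and
-- E = 1 + (k - 1) D the assumed bounds on r and w imply r < E and w D < E, hence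
-- E t = t + (k - 1) D t ≤ M (c + (k - 1) m) + O(1) ≤ M n + O(1) for some M < E,
-- which fails for large n.
module Submission where

module BlowUps where

  open import Defs
    using (Graph; Adj; FalseTwins; TrueTwins; InducedCopy; _∖_; DeletionSet;
           MinimumDeletionSet; IsOPT; OnlineGraph; ∅; _▷_; OnlineAdj; ⟦_⟧; Algorithm)
  open import Data.Bool using (true; not; _∧_)
  open import Data.Bool.Properties using (∧-zeroʳ)
  open import Data.Fin using (Fin; zero; suc; punchOut)
  open import Data.Fin.Properties using (_≟_; any?; punchOut-injective; injective⇒≤)
  open import Data.Fin.Subset
    using (Subset; inside; outside; _∈_; _∉_; _⊆_; ∣_∣; ∁; _∩_; ⊤; Empty; Nonempty; ⁅_⁆)
  open import Data.Fin.Subset.Properties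
    using (nonempty?; _∈?_; Empty-unique; ∣⊥∣≡0; ∣⊤∣≡n; ∣⁅x⁆∣≡1; x∈⁅y⁆⇒x≡y; ∣∁p∣≡n∸∣p∣;
           ∣p∣≤n; ∣p∣≤∣x∷p∣; p⊆q⇒∣p∣≤∣q∣; p⊂q⇒∣p∣<∣q∣; ⊆-antisym; x∈p∩q⁺; x∈p∩q⁻;
           x∉∁p⇒x∈p; x∉p⇒x∈∁p; x∈∁p⇒x∉p; ∩-identityˡ; drop-there)
  open import Data.Irrelevant using () renaming ([_] to irr)
  open import Data.List using (allFin)
  open import Data.List.Extrema.Nat using (argmin; f[argmin]≤f[xs])
  open import Data.List.Membership.Propositional.Properties using (∈-allFin)
  import Data.List.Relation.Unary.All as All
  open import Data.Nat using (ℕ; zero; suc; _+_; _*_; _∸_; _≤_; _<_; z≤n; s≤s)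
  open import Data.Nat.Properties
    using (≤-refl; ≤-reflexive; ≤-trans; <-≤-trans; m≤n⇒m≤1+n; m≤m+n; +-mono-≤; +-monoʳ-≤;
           +-suc; +-0-commutativeMonoid; <⇒≱; <⇒≤; 1+n≰n; m≤n+m∸n; +-comm;
           module ≤-Reasoning)
  open import Algebra.Properties.CommutativeMonoid.Sum +-0-commutativeMonoid using (sum; sum-cong-≗)
  open import Data.Product using (∃-syntax; _×_; _,_; proj₁; proj₂)
  open import Data.Refinement using (Refinement-syntax; value; value-injective; _,_)
  open import Data.Sum using (_⊎_; inj₁; inj₂; [_,_])
  open import Data.Vec using (Vec; []; _∷_; _++_; map; lookup; tabulate)
  open import Data.Vec.Properties using (lookup-map; lookup⇒[]=; []=⇒lookup; lookup∘tabulate)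
  open import Function using (_∘_; _⇔_; mk⇔; Equivalence)
  open import Function.Definitions using (Injective)
  open import Function.Construct.Composition using (_⇔-∘_)
  open import Function.Construct.Symmetry using (⇔-sym)
  open import Level using (0ℓ)
  open import Relation.Binary using (Rel; Symmetric; Decidable)
  open import Relation.Binary.PropositionalEquality
    using (_≡_; _≢_; refl; sym; trans; cong; cong₂; subst)
  open import Relation.Nullary using (¬_; yes; no; does; ¬?; contradiction; _⊎-dec_)
  open import Relation.Nullary.Decidable using (dec-true; decidable-stable)
  open import Relation.Nullary.Negation using (contradiction-irr)
  import Relation.Unary as U
  open Equivalence using (to; from)

  private
    ⇔-trans : {A B D : Set} → A ⇔ B → B ⇔ D → A ⇔ D
    ⇔-trans f g = g ⇔-∘ f

    variable
      k n n′ : ℕ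
      C : Set

  -- Subsets of finite sets and finite sums.

  select : {P : C → Set} → U.Decidable P → Vec C n → Subset n
  select P? = map (does ∘ P?)

  ∈-select : {P : C → Set} (P? : U.Decidable P) (xs : Vec C n) {v : Fin n} →
             v ∈ select P? xs ⇔ P (lookup xs v)
  ∈-select {P = P} P? xs {v} = mk⇔ (λ v∈ → sound ([]=⇒lookup v∈))
    (λ Pv → lookup⇒[]= v _ (trans (lookup-map v _ xs) (dec-true (P? _) Pv)))
    where
    sound : lookup (select P? xs) v ≡ true → P (lookup xs v)
    sound eq with P? (lookup xs v) | trans (sym (lookup-map v (does ∘ P?) xs)) eq
    ... | yes Pv | _ = Pv
    ... | no _   | ()

  Empty⇒∣p∣≡0 : {p : Subset n} → Empty p → ∣ p ∣ ≡ 0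
  Empty⇒∣p∣≡0 {n = n} e = trans (cong ∣_∣ (Empty-unique e)) (∣⊥∣≡0 n)

  x∈p⇒0<∣p∣ : {p : Subset n} {x : Fin n} → x ∈ p → 0 < ∣ p ∣
  x∈p⇒0<∣p∣ {p = p} {x} x∈p = subst (_≤ ∣ p ∣) (∣⁅x⁆∣≡1 x)
    (p⊆q⇒∣p∣≤∣q∣ λ y∈ → subst (_∈ p) (sym (x∈⁅y⁆⇒x≡y x y∈)) x∈p)

  ⊆∧∣q∣≤∣p∣⇒p≡q : {p q : Subset n} → p ⊆ q → ∣ q ∣ ≤ ∣ p ∣ → p ≡ q
  ⊆∧∣q∣≤∣p∣⇒p≡q {p = p} {q} p⊆q ∣q∣≤∣p∣ = ⊆-antisym p⊆q λ {x} x∈q →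
    decidable-stable (x ∈? p) λ x∉p →
      <⇒≱ (p⊂q⇒∣p∣<∣q∣ (p⊆q , x , x∈q , x∉p)) ∣q∣≤∣p∣

  -- If `i` were missed, `punchOut` at `i` would turn `f` into an injection into a set with one
  -- element fewer.
  injective⇒surjective : (f : Fin k → Fin k) → Injective _≡_ _≡_ f → ∀ i → ∃[ j ] f j ≡ i
  injective⇒surjective {suc k} f f-inj i with any? (λ j → f j ≟ i)
  ... | yes j  = j
  ... | no ∄j = contradiction
    (injective⇒≤ {f = λ j → punchOut {i = i} {f j} (λ i≡fj → ∄j (j , sym i≡fj))}
      (λ eq → f-inj (punchOut-injective {i = i} _ _ eq)))
    1+n≰n

  ∣x∷p∣≤1+∣p∣ : ∀ x (p : Subset n) → ∣ x ∷ p ∣ ≤ suc ∣ p ∣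
  ∣x∷p∣≤1+∣p∣ outside p = m≤n⇒m≤1+n ≤-refl
  ∣x∷p∣≤1+∣p∣ inside  p = ≤-refl

  sum-bump : (f g : Fin k → ℕ) (c : Fin k) → g c ≡ suc (f c) → (∀ i → c ≢ i → g i ≡ f i) →
             sum g ≡ suc (sum f)
  sum-bump f g zero    gc g≗f = cong₂ _+_ gc (sum-cong-≗ λ i → g≗f (suc i) λ ())
  sum-bump f g (suc c) gc g≗f = trans
    (cong₂ _+_ (g≗f zero λ ())
      (sum-bump (f ∘ suc) (g ∘ suc) c gc λ i c≢i → g≗f (suc i) λ { refl → c≢i refl }))
    (+-suc (f zero) _)

  sum-lower : (f : Fin k → ℕ) {m : ℕ} → (∀ i → m ≤ f i) → k * m ≤ sum f
  sum-lower {zero}  f m≤ = z≤n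
  sum-lower {suc k} f m≤ = +-mono-≤ (m≤ zero) (sum-lower (f ∘ suc) (m≤ ∘ suc))

  sum-≤1 : (f : Fin k → ℕ) → (∀ i → f i ≤ 1) → sum f ≤ k
  sum-≤1 {zero}  f ≤1 = z≤n
  sum-≤1 {suc k} f ≤1 = +-mono-≤ (≤1 zero) (sum-≤1 (f ∘ suc) (≤1 ∘ suc))

  -- Colour classes.

  class : Fin k → Vec (Fin k) n → Subset n
  class i = select (_≟ i)

  ∈-class : {i : Fin k} (cs : Vec (Fin k) n) {v : Fin n} → v ∈ class i cs ⇔ lookup cs v ≡ i
  ∈-class {i = i} = ∈-select (_≟ i)

  ∣class∣-++ : (i : Fin k) (xs : Vec (Fin k) n′) (ys : Vec (Fin k) n) →
               ∣ class i (xs ++ ys) ∣ ≡ ∣ class i xs ∣ + ∣ class i ys ∣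
  ∣class∣-++ i []       ys = refl
  ∣class∣-++ i (x ∷ xs) ys with x ≟ i
  ... | yes _ = cong suc (∣class∣-++ i xs ys)
  ... | no _  = ∣class∣-++ i xs ys

  -- Every vertex has exactly one colour, so an element of `p` of colour `c` contributes to the
  -- summand at `c` alone.
  sum-classes : (p : Subset n) (cs : Vec (Fin k) n) → sum (λ i → ∣ p ∩ class i cs ∣) ≡ ∣ p ∣
  sum-classes {k = k} [] [] = sum-zero k
    where
    sum-zero : ∀ k → sum {k} (λ _ → 0) ≡ 0
    sum-zero zero    = refl
    sum-zero (suc k) = sum-zero k
  sum-classes (outside ∷ p) (c ∷ cs) = sum-classes p cs
  sum-classes (inside  ∷ p) (c ∷ cs) = trans
    (sum-bump (λ i → ∣ p ∩ class i cs ∣) _ c at-c off-c) (cong suc (sum-classes p cs))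
    where
    at-c : ∣ (inside ∷ p) ∩ class c (c ∷ cs) ∣ ≡ suc ∣ p ∩ class c cs ∣
    at-c with c ≟ c
    ... | yes _   = refl
    ... | no c≢c = contradiction refl c≢c
    off-c : ∀ i → c ≢ i → ∣ (inside ∷ p) ∩ class i (c ∷ cs) ∣ ≡ ∣ p ∩ class i cs ∣
    off-c i c≢i with c ≟ i
    ... | yes c≡i = contradiction c≡i c≢i
    ... | no _    = refl

  -- Adjacency rules for blow-ups of `H`.

  record BlowUpRule (H : Graph (Fin k)) : Set₁ where
    infix 4 _~_ _~?_
    field
      -- Adjacency of two distinct vertices in terms of their colours. The value on equal colours
      -- decides whether a class is a clique or independent.
      _~_       : Rel (Fin k) 0ℓ
      ~-sym     : Symmetric _~_
      _~?_      : Decidable _~_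
      extends   : ∀ {i j} → i ≢ j → Adj H i j ⇔ i ~ j
      -- Here `g` lists the colours along an induced copy of `H`, so injectivity says that no copy
      -- repeats a colour. Only distinct `u` and `v` are compared, because a vertex is not adjacent
      -- to itself even inside a clique class.
      separates : (g : Fin k → Fin k) → (∀ {u v} → u ≢ v → Adj H u v ⇔ g u ~ g v) →
                  Injective _≡_ _≡_ g

  -- Distinct vertices of `H` with the same image under `g` would have the same open neighbourhood,
  -- and so be false twins.
  independentClasses : (H : Graph (Fin k)) → ¬ (∃[ u ] ∃[ v ] FalseTwins H u v) → BlowUpRule H
  independentClasses H ∄twins = record
    { _~_       = Adj H
    ; ~-sym     = symmetric
    ; _~?_      = adj?
    ; extends   = λ _ → mk⇔ (λ e → e) (λ e → e)
    ; separates = separates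
    }
    where
    open Graph H using (symmetric; irreflexive; adj?)
    separates : ∀ g → (∀ {u v} → u ≢ v → Adj H u v ⇔ Adj H (g u) (g v)) → Injective _≡_ _≡_ g
    separates g edge {u} {v} gu≡gv = decidable-stable (u ≟ v) λ u≢v →
      ∄twins (u , v , u≢v , λ w → ⇔-trans (nbr u w)
        (⇔-sym (subst (λ x → Adj H v w ⇔ Adj H x (g w)) (sym gu≡gv) (nbr v w))))
      where
      nbr : ∀ u w → Adj H u w ⇔ Adj H (g u) (g w)
      nbr u w with u ≟ w
      -- `edge` covers distinct vertices only; on the diagonal both sides are false.
      ... | yes refl = mk⇔ (λ e → contradiction e irreflexive) (λ e → contradiction e irreflexive)
      ... | no u≢w   = edge u≢w

  -- The same argument with closed neighbourhoods: a collision of `g` would produce true twins.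
  cliqueClasses : (H : Graph (Fin k)) → ¬ (∃[ u ] ∃[ v ] TrueTwins H u v) → BlowUpRule H
  cliqueClasses H ∄twins = record
    { _~_       = λ i j → i ≡ j ⊎ Adj H i j
    ; ~-sym     = λ { (inj₁ i≡j) → inj₁ (sym i≡j) ; (inj₂ e) → inj₂ (symmetric e) }
    ; _~?_      = λ i j → (i ≟ j) ⊎-dec adj? i j
    ; extends   = λ i≢j → mk⇔ inj₂ [ (λ i≡j → contradiction i≡j i≢j) , (λ e → e) ]
    ; separates = separates
    }
    where
    open Graph H using (symmetric; adj?)
    separates : ∀ g → (∀ {u v} → u ≢ v → Adj H u v ⇔ (g u ≡ g v ⊎ Adj H (g u) (g v))) →
                Injective _≡_ _≡_ g
    separates g edge {u} {v} gu≡gv = decidable-stable (u ≟ v) λ u≢v →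
      ∄twins (u , v , u≢v , λ w → ⇔-trans (nbr u w)
        (⇔-sym (subst (λ x → (w ≡ v ⊎ Adj H v w) ⇔ (x ≡ g w ⊎ Adj H x (g w)))
                 (sym gu≡gv) (nbr v w))))
      where
      nbr : ∀ u w → (w ≡ u ⊎ Adj H u w) ⇔ (g u ≡ g w ⊎ Adj H (g u) (g w))
      nbr u w with u ≟ w
      ... | yes refl = mk⇔ (λ _ → inj₁ refl) (λ _ → inj₁ refl)
      ... | no u≢w   = mk⇔
        [ (λ w≡u → contradiction (sym w≡u) u≢w) , to (edge u≢w) ] (inj₂ ∘ from (edge u≢w))

  -- Blow-ups, their deletion sets and their optimum.

  module BlowUp {H : Graph (Fin k)} (rule : BlowUpRule H) where

    open BlowUpRule rule

    blowUp : Vec (Fin k) n → OnlineGraph n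
    blowUp []       = ∅
    blowUp (c ∷ cs) = blowUp cs ▷ select (c ~?_) cs

    blowUp-adj : (cs : Vec (Fin k) n) {u v : Fin n} → u ≢ v →
                 OnlineAdj (blowUp cs) u v ⇔ lookup cs u ~ lookup cs v
    blowUp-adj (c ∷ cs) {zero}  {zero}  u≢v = contradiction refl u≢v
    blowUp-adj (c ∷ cs) {zero}  {suc v} u≢v = ∈-select (c ~?_) cs
    blowUp-adj (c ∷ cs) {suc u} {zero}  u≢v =
      ⇔-trans (∈-select (c ~?_) cs) (mk⇔ ~-sym ~-sym)
    blowUp-adj (c ∷ cs) {suc u} {suc v} u≢v = blowUp-adj cs (u≢v ∘ cong suc)

    -- By `separates` the colours along a copy of `H` form an injective map, hence a surjective one,
    -- so every copy meets class `i`.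
    class-deletion : (cs : Vec (Fin k) n) (i : Fin k) →
                     DeletionSet H ⟦ blowUp cs ⟧ (class i cs)
    class-deletion {n = n} cs i copy = missed (embed u) gu≡i
      where
      open InducedCopy copy
      g : Fin k → Fin k
      g u = lookup cs (value (embed u))
      g-injective : Injective _≡_ _≡_ g
      g-injective = separates g λ {u} {v} u≢v →
        ⇔-trans (induced u v) (blowUp-adj cs (u≢v ∘ injective ∘ value-injective))
      hit : ∃[ u ] g u ≡ i
      hit = injective⇒surjective g g-injective i
      u    = proj₁ hit
      gu≡i = proj₂ hit
      missed : (v : [ v ∈ Fin n ∣ v ∉ class i cs ]) → lookup cs (value v) ≢ i
      -- The membership proof inside the refinement is irrelevant, so it serves only to reach a
      -- contradiction.
      missed (v , irr v∉) cv≡i = contradiction-irr v∉ λ v∉ → v∉ (from (∈-class cs) cv≡i)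

    -- Kept representatives of different classes have different colours, so `extends` matches their
    -- adjacency with that of `H`.
    copy-of-transversal : (cs : Vec (Fin k) n) (X : Subset n) →
                          (∀ i → Nonempty (∁ X ∩ class i cs)) → InducedCopy H (⟦ blowUp cs ⟧ ∖ X)
    copy-of-transversal cs X nonempty = record
      { embed     = λ i → rep i , irr (x∈∁p⇒x∉p (proj₁ (rep-∈ i)))
      ; injective = λ {i} {j} eq →
          trans (sym (colour i)) (trans (cong (lookup cs) (cong value eq)) (colour j))
      ; induced   = induced
      }
      where
      rep : Fin k → Fin _
      rep i = proj₁ (nonempty i)
      rep-∈ : ∀ i → rep i ∈ ∁ X × rep i ∈ class i cs
      rep-∈ i = x∈p∩q⁻ (∁ X) (class i cs) (proj₂ (nonempty i))
      colour : ∀ i → lookup cs (rep i) ≡ i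
      colour i = to (∈-class cs) (proj₂ (rep-∈ i))
      induced : ∀ i j → Adj H i j ⇔ OnlineAdj (blowUp cs) (rep i) (rep j)
      induced i j with i ≟ j
      ... | yes refl = mk⇔ (λ e → contradiction e (Graph.irreflexive H))
                           (λ e → contradiction e (Graph.irreflexive ⟦ blowUp cs ⟧))
      ... | no i≢j   = ⇔-trans (extends i≢j) (⇔-sym
        (subst (λ x → OnlineAdj (blowUp cs) (rep i) (rep j) ⇔ x) (cong₂ _~_ (colour i) (colour j))
          (blowUp-adj cs λ eq → i≢j (trans (sym (colour i)) (trans (cong (lookup cs) eq) (colour j))))))

    -- Otherwise every class keeps a vertex, and these form a copy of `H`.
    deletes-class : (cs : Vec (Fin k) n) (X : Subset n) → DeletionSet H ⟦ blowUp cs ⟧ X →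
                    ∃[ i ] Empty (∁ X ∩ class i cs)
    deletes-class cs X free with any? (λ i → ¬? (nonempty? (∁ X ∩ class i cs)))
    ... | yes found = found
    ... | no ∄empty = contradiction
      (copy-of-transversal cs X λ i →
        decidable-stable (nonempty? (∁ X ∩ class i cs)) λ e → ∄empty (i , e))
      free

    sum-class-sizes : (cs : Vec (Fin k) n) → sum (λ i → ∣ class i cs ∣) ≡ n
    sum-class-sizes {n = n} cs = trans
      (sum-cong-≗ λ i → cong ∣_∣ (sym (∩-identityˡ (class i cs))))
      (trans (sum-classes ⊤ cs) (∣⊤∣≡n n))

    kept-empty⇒class⊆ : (cs : Vec (Fin k) n) (X : Subset n) {i : Fin k} →
                       Empty (∁ X ∩ class i cs) → class i cs ⊆ X
    kept-empty⇒class⊆ cs X empty {v} v∈ = x∉∁p⇒x∈p λ v∈∁X → empty (v , x∈p∩q⁺ (v∈∁X , v∈))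

    smallest-class-optimal : (cs : Vec (Fin k) n) (i : Fin k) →
      (∀ j → ∣ class i cs ∣ ≤ ∣ class j cs ∣) → IsOPT H ⟦ blowUp cs ⟧ ∣ class i cs ∣
    smallest-class-optimal cs i i-min = class i cs , (class-deletion cs i , minimum) , refl
      where
      minimum : ∀ Y → DeletionSet H ⟦ blowUp cs ⟧ Y → ∣ class i cs ∣ ≤ ∣ Y ∣
      minimum Y del with j , empty ← deletes-class cs Y del =
        ≤-trans (i-min j) (p⊆q⇒∣p∣≤∣q∣ (kept-empty⇒class⊆ cs Y empty))

    -- A minimum set contains some class. A class other than `i` is too large, and containing class
    -- `i` without exceeding its size forces equality. This pins down the correct advice.
    strictly-smallest-class-unique : (cs : Vec (Fin k) n) (i : Fin k) →
      (∀ j → i ≢ j → ∣ class i cs ∣ < ∣ class j cs ∣) →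
      (X : Subset n) → MinimumDeletionSet H ⟦ blowUp cs ⟧ X → X ≡ class i cs
    strictly-smallest-class-unique cs i i-min X (del , X-min)
      with j , empty ← deletes-class cs X del | i ≟ j
    ... | yes refl = sym (⊆∧∣q∣≤∣p∣⇒p≡q (kept-empty⇒class⊆ cs X empty)
                           (X-min (class i cs) (class-deletion cs i)))
    ... | no i≢j   = contradiction (X-min (class i cs) (class-deletion cs i))
      (<⇒≱ (<-≤-trans (i-min j i≢j) (p⊆q⇒∣p∣≤∣q∣ (kept-empty⇒class⊆ cs X empty))))

  smallest : (f : Fin (suc k) → ℕ) → ∃[ i ] ∀ j → f i ≤ f j
  smallest f = argmin f zero (allFin _) , λ j →
    All.lookup (f[argmin]≤f[xs] {f = f} zero (allFin _)) (∈-allFin j)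

  -- Padding the classes of nonzero colour.

  padding-length : ℕ → ℕ → ℕ
  padding-length k zero    = 0
  padding-length k (suc N) = k + padding-length k N

  -- Each of the `N` rounds adds one vertex of every nonzero colour.
  padding : ∀ N → Vec (Fin (suc k)) (padding-length k N)
  padding zero    = []
  padding (suc N) = tabulate suc ++ padding N

  padding-avoids-zero : ∀ N → ∣ class {suc k} zero (padding N) ∣ ≡ 0
  padding-avoids-zero zero    = refl
  padding-avoids-zero {k} (suc N) = trans (∣class∣-++ zero (tabulate {n = k} suc) (padding N))
    (cong₂ _+_ (Empty⇒∣p∣≡0 λ (v , v∈) →
        suc≢zero (trans (sym (lookup∘tabulate suc v)) (to (∈-class (tabulate suc)) v∈)))
      (padding-avoids-zero {k} N))
    where
    suc≢zero : {i : Fin k} → suc i ≢ zero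
    suc≢zero ()

  padding-fills-suc : ∀ N (j : Fin k) → N ≤ ∣ class (suc j) (padding N) ∣
  padding-fills-suc zero    j = z≤n
  padding-fills-suc (suc N) j = ≤-trans
    (+-mono-≤ (x∈p⇒0<∣p∣ (from (∈-class (tabulate suc)) (lookup∘tabulate suc j)))
              (padding-fills-suc N j))
    (≤-reflexive (sym (∣class∣-++ (suc j) (tabulate suc) (padding N))))

  -- The game between the adversary and the algorithm.

  module Game {H : Graph (Fin (suc k))} (rule : BlowUpRule H) (A : Algorithm H) where

    open BlowUp rule
    open Algorithm A

    -- The bit of a vertex depends on its colour alone, so later vertices leave earlier bits
    -- unchanged and `increasing` applies along the game.
    advice : Vec (Fin (suc k)) n → Subset n
    advice = class zero

    response : Vec (Fin (suc k)) n → Subset n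
    response cs = deleted (blowUp cs) (advice cs)

    response-increasing : (c : Fin (suc k)) (cs : Vec (Fin (suc k)) n) {v : Fin n} →
                          v ∈ response cs → suc v ∈ response (c ∷ cs)
    response-increasing c cs =
      increasing (blowUp cs) (select (BlowUpRule._~?_ rule c) cs) (advice cs) (does (c ≟ zero))

    -- Vectors list the newest vertex first, so `es ++ cs` continues the game `cs`; deletions are
    -- never undone.
    ∣response∣-mono : (es : Vec (Fin (suc k)) n′) (cs : Vec (Fin (suc k)) n) →
                      ∣ response cs ∣ ≤ ∣ response (es ++ cs) ∣
    ∣response∣-mono []       cs = ≤-refl
    ∣response∣-mono (e ∷ es) cs = ≤-trans (∣response∣-mono es cs)
      (shift _ _ (response-increasing e (es ++ cs)))
      where
      shift : ∀ {n} (p : Subset n) (q : Subset (suc n)) → (∀ {v} → v ∈ p → suc v ∈ q) →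
              ∣ p ∣ ≤ ∣ q ∣
      shift p (x ∷ q) p⊆q = ≤-trans (p⊆q⇒∣p∣≤∣q∣ (drop-there ∘ p⊆q)) (∣p∣≤∣x∷p∣ x q)

    AtMostOneKept : Vec (Fin (suc k)) n → Set
    AtMostOneKept cs = ∀ i → ∣ ∁ (response cs) ∩ class i cs ∣ ≤ 1

    -- In class `c` only the new vertex can be kept; in the other classes the kept part can only
    -- shrink.
    extend : (c : Fin (suc k)) (cs : Vec (Fin (suc k)) n) →
             Empty (∁ (response cs) ∩ class c cs) → AtMostOneKept cs → AtMostOneKept (c ∷ cs)
    -- Abstracting the new response as `q` lets it be split into the bit of the new vertex and the
    -- rest.
    extend c cs empty kept i = go (response (c ∷ cs)) (response-increasing c cs)
      where
      go : ∀ q → (∀ {v} → v ∈ response cs → suc v ∈ q) → ∣ ∁ q ∩ class i (c ∷ cs) ∣ ≤ 1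
      go (x ∷ q) p⊆q = bound
        where
        shrink : ∁ q ∩ class i cs ⊆ ∁ (response cs) ∩ class i cs
        shrink v∈ with v∈∁q , v∈i ← x∈p∩q⁻ (∁ q) (class i cs) v∈ =
          x∈p∩q⁺ (x∉p⇒x∈∁p (x∈∁p⇒x∉p v∈∁q ∘ drop-there ∘ p⊆q) , v∈i)
        bound : ∣ ∁ (x ∷ q) ∩ class i (c ∷ cs) ∣ ≤ 1
        bound with c ≟ i
        ... | yes refl = ≤-trans (∣x∷p∣≤1+∣p∣ (not x ∧ true) (∁ q ∩ class c cs)) (s≤s (≤-reflexive
                (Empty⇒∣p∣≡0 λ (v , v∈) → empty (v , shrink v∈))))
        ... | no _     = subst (λ b → ∣ b ∷ (∁ q ∩ class i cs) ∣ ≤ 1) (sym (∧-zeroʳ (not x)))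
                (≤-trans (p⊆q⇒∣p∣≤∣q∣ shrink) (kept i))

    -- The next colour is that of a class which the current response deletes entirely; `solves`
    -- guarantees that one exists.
    play : ∀ n → ∃[ cs ] AtMostOneKept {n} cs
    play zero    = [] , λ i → ≤-trans (∣p∣≤n (∁ (response []) ∩ class i [])) z≤n
    play (suc n) with cs , kept ← play n
                 with c , empty ← deletes-class cs (response cs) (solves (blowUp cs) (advice cs))
      = c ∷ cs , extend c cs empty kept

    -- There are `suc k` colours, and each accounts for at most one kept vertex.
    n≤k+∣response∣ : (cs : Vec (Fin (suc k)) n) → AtMostOneKept cs → n ≤ suc k + ∣ response cs ∣
    n≤k+∣response∣ {n} cs kept = begin
      n                              ≤⟨ m≤n+m∸n n ∣ S ∣ ⟩
      ∣ S ∣ + (n ∸ ∣ S ∣)            ≡⟨ cong (∣ S ∣ +_) (∣∁p∣≡n∸∣p∣ S) ⟨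
      ∣ S ∣ + ∣ ∁ S ∣                ≡⟨ cong (∣ S ∣ +_) (sum-classes (∁ S) cs) ⟨
      ∣ S ∣ + sum (λ i → ∣ ∁ S ∩ class i cs ∣) ≤⟨ +-monoʳ-≤ ∣ S ∣ (sum-≤1 _ kept) ⟩
      ∣ S ∣ + suc k                  ≡⟨ +-comm ∣ S ∣ (suc k) ⟩
      suc k + ∣ S ∣                  ∎
      where
      S = response cs
      open ≤-Reasoning

    -- Class zero has at most `n` vertices and gains none, so `suc n` rounds, one more than `n`,
    -- make it strictly the smallest.
    pad : Vec (Fin (suc k)) n → Vec (Fin (suc k)) (padding-length k (suc n) + n)
    pad {n} cs = padding (suc n) ++ cs

    ∣class-zero-pad∣ : (cs : Vec (Fin (suc k)) n) → ∣ class zero (pad cs) ∣ ≡ ∣ class zero cs ∣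
    ∣class-zero-pad∣ {n} cs = trans (∣class∣-++ zero (padding (suc n)) cs)
      (cong (_+ ∣ class zero cs ∣) (padding-avoids-zero {k} (suc n)))

    pad-class-zero-smallest : (cs : Vec (Fin (suc k)) n) (j : Fin (suc k)) → zero ≢ j →
                              ∣ class zero (pad cs) ∣ < ∣ class j (pad cs) ∣
    pad-class-zero-smallest     cs zero    0≢0 = contradiction refl 0≢0
    pad-class-zero-smallest {n} cs (suc j) _   = begin-strict
      ∣ class zero (pad cs) ∣              ≡⟨ ∣class-zero-pad∣ cs ⟩
      ∣ class zero cs ∣                    ≤⟨ ∣p∣≤n (class zero cs) ⟩
      n                                    <⟨ padding-fills-suc (suc n) j ⟩
      ∣ class (suc j) (padding (suc n)) ∣  ≤⟨ m≤m+n _ _ ⟩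
      ∣ class (suc j) (padding (suc n)) ∣ + ∣ class (suc j) cs ∣
        ≡⟨ ∣class∣-++ (suc j) (padding (suc n)) cs ⟨
      ∣ class (suc j) (pad cs) ∣           ∎
      where open ≤-Reasoning

    pad-OPT : (cs : Vec (Fin (suc k)) n) → IsOPT H ⟦ blowUp (pad cs) ⟧ ∣ class zero cs ∣
    pad-OPT cs = subst (IsOPT H ⟦ blowUp (pad cs) ⟧) (∣class-zero-pad∣ cs)
      (smallest-class-optimal (pad cs) zero least)
      where
      least : ∀ j → ∣ class zero (pad cs) ∣ ≤ ∣ class j (pad cs) ∣
      least zero    = ≤-refl
      least (suc j) = <⇒≤ (pad-class-zero-smallest cs (suc j) λ ())

    -- The data for counting. In `classes`, each of the `k` classes of nonzero colour has at least
    -- `opt` vertices; in `expense`, all but at most `suc k` vertices are deleted.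
    record Run (n : ℕ) : Set where
      field
        colours : Vec (Fin (suc k)) n
        opt     : ℕ
        isOPT   : IsOPT H ⟦ blowUp colours ⟧ opt
        classes : ∣ class zero colours ∣ + k * opt ≤ n
        expense : n ≤ suc k + ∣ response colours ∣

    run : ∀ n → Run n
    run n = record
      { colours = cs
      ; opt     = ∣ class i cs ∣
      ; isOPT   = smallest-class-optimal cs i i-min
      ; classes = subst (∣ class zero cs ∣ + k * ∣ class i cs ∣ ≤_) (sum-class-sizes cs)
          (+-monoʳ-≤ ∣ class zero cs ∣ (sum-lower (λ j → ∣ class (suc j) cs ∣) (i-min ∘ suc)))
      ; expense = n≤k+∣response∣ cs (proj₂ (play n))
      }
      where
      cs    = proj₁ (play n)
      least = smallest (λ i → ∣ class i cs ∣)
      i     = proj₁ least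
      i-min = proj₂ least

module RationalBounds where

  open import Defs using (ℝ; seq; cauchy; recip; recip-inverse; fromℕ)
  import Defs as ℝ
  open import Data.Integer.Base as ℤ using (ℤ; +_)
  import Data.Integer.Properties as ℤ
  open import Data.Nat.Base as ℕ using (ℕ; suc)
  import Data.Nat.Properties as ℕ
  import Data.Nat.Coprimality as C
  open import Data.Product using (∃-syntax; _×_; _,_)
  open import Data.Rational
  open import Data.Rational.Properties
  open import Data.Rational.Solver using (module +-*-Solver)
  open import Relation.Binary.PropositionalEquality
    using (_≡_; refl; sym; trans; cong; cong₂; subst; module ≡-Reasoning)
  open import Data.Sum using (inj₁; inj₂)
  open +-*-Solver using (solve; con; _:+_; _:*_; _:-_; :-_; _:=_)

  -- Natural numbers in the rationals.

  ι : ℕ → ℚ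
  ι m = + m / 1

  -- The gcd normalisation in `_/_` does not compute for a variable `m`; this explicit form lets
  -- order and arithmetic reduce.
  ι≡mkℚ : ∀ m → ι m ≡ mkℚ (+ m) 0 (C.sym (C.1-coprimeTo m))
  ι≡mkℚ m = normalize-coprime (C.sym (C.1-coprimeTo m))

  ι-mono-≤ : ∀ {m n} → m ℕ.≤ n → ι m ≤ ι n
  ι-mono-≤ {m} {n} m≤n rewrite ι≡mkℚ m | ι≡mkℚ n =
    *≤* (ℤ.*-monoʳ-≤-nonNeg (+ 1) (ℤ.+≤+ m≤n))

  ι-+ : ∀ m n → ι (m ℕ.+ n) ≡ ι m + ι n
  ι-+ m n rewrite ι≡mkℚ m | ι≡mkℚ n =
    cong (_/ 1) (sym (cong₂ ℤ._+_ (ℤ.*-identityʳ (+ m)) (ℤ.*-identityʳ (+ n))))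

  ι-* : ∀ m n → ι (m ℕ.* n) ≡ ι m * ι n
  ι-* m n rewrite ι≡mkℚ m | ι≡mkℚ n = cong (_/ 1) (ℤ.pos-* m n)

  0≤ι : ∀ m → 0ℚ ≤ ι m
  0≤ι m = ι-mono-≤ {0} {m} ℕ.z≤n

  -- Denominators are at least one, so one more than the absolute value of the numerator suffices.
  archimedean : ∀ q → ∃[ n ] q < ι n
  archimedean (mkℚ a d c) = suc ℤ.∣ a ∣ , subst (mkℚ a d c <_) (sym (ι≡mkℚ (suc ℤ.∣ a ∣)))
    (*<* (numerator< a))
    where
    numerator< : ∀ a → a ℤ.* + 1 ℤ.< + suc ℤ.∣ a ∣ ℤ.* + suc d
    numerator< (+ m) = subst (ℤ._< + suc m ℤ.* + suc d) (sym (ℤ.*-identityʳ (+ m)))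
      (ℤ.+<+ (ℕ.m≤m*n (suc m) (suc d)))
    numerator< ℤ.-[1+ m ] = ℤ.-<+

  *-pos : ∀ {a b} → 0ℚ < a → 0ℚ < b → 0ℚ < a * b
  *-pos {a} {b} 0<a 0<b = subst (_< a * b) (*-zeroʳ a) (*-monoʳ-<-pos a {{positive 0<a}} 0<b)

  archimedean-scaled : ∀ {e} → 0ℚ < e → ∀ q → ∃[ n ] q < e * ι n
  archimedean-scaled {e} 0<e q = let n , q/e<n = archimedean (recip e * q) in n , (begin-strict
    q                 ≡⟨ *-identityˡ q ⟨
    1ℚ * q            ≡⟨ cong (_* q) (trans (*-comm e (recip e)) (recip-inverse 0<e)) ⟨
    e * recip e * q   ≡⟨ *-assoc e (recip e) q ⟩
    e * (recip e * q) <⟨ *-monoʳ-<-pos e {{positive 0<e}} q/e<n ⟩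
    e * ι n           ∎)
    where open ≤-Reasoning

  0<q-p : ∀ {p q} → p < q → 0ℚ < q - p
  0<q-p {p} {q} p<q = subst (_< q - p) (+-inverseʳ p) (+-monoˡ-< (- p) p<q)

  -- Rational bounds for real numbers.

  infix 4 _≼_
  -- An eventual termwise bound, stronger than the order on the reals and directly usable at large
  -- indices.
  _≼_ : ℝ → ℚ → Set
  x ≼ q = ∃[ N ] ∀ i → N ℕ.≤ i → seq x i ≤ q

  half-pos : ∀ {ε} → 0ℚ < ε → 0ℚ < ½ * ε
  half-pos = *-pos (positive⁻¹ ½)

  half-< : ∀ {ε} → 0ℚ < ε → ½ * ε < ε
  half-< {ε} 0<ε = subst (½ * ε <_) (*-identityˡ ε)
    (*-monoˡ-<-pos ε {{positive 0<ε}} {½} {1ℚ} (*<* (ℤ.+<+ ℕ.≤-refl)))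

  close⇒≤ : ∀ {a b ε} → ∣ b - a ∣ < ε → b ≤ a + ε
  close⇒≤ {a} {b} {ε} d = begin
    b             ≡⟨ solve 2 (λ a b → b := a :+ (b :- a)) refl a b ⟩
    a + (b - a)   ≤⟨ +-monoʳ-≤ a (p≤∣p∣ (b - a)) ⟩
    a + ∣ b - a ∣ ≤⟨ +-monoʳ-≤ a (<⇒≤ d) ⟩
    a + ε         ∎
    where
    open ≤-Reasoning
    p≤∣p∣ : ∀ p → p ≤ ∣ p ∣
    p≤∣p∣ p with ≤-total 0ℚ p
    ... | inj₁ 0≤p = ≤-reflexive (sym (0≤p⇒∣p∣≡p 0≤p))
    ... | inj₂ p≤0 = ≤-trans p≤0 (0≤∣p∣ p)

  bounded-above : ∀ x → ∃[ q ] x ≼ q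
  bounded-above x =
    let N , h = cauchy x 1ℚ (positive⁻¹ 1ℚ) in
    seq x N + 1ℚ , N , λ i N≤i → close⇒≤ (h i N N≤i ℕ.≤-refl)

  eventually-< : ∀ {x y} → x ℝ.< y → ∃[ N ] ∀ i → N ℕ.≤ i → seq x i < seq y i
  eventually-< {x} {y} (ε , 0<ε , N , x+ε≤y) = N , λ i N≤i →
    <-≤-trans (subst (_< seq x i + ε) (+-identityʳ (seq x i)) (+-monoʳ-< (seq x i) 0<ε))
              (x+ε≤y i N≤i)

  -- From a large `i` on, `x` stays within half the gap of its `i`-th term. The bound is compared
  -- with the single term `seq y i`, so that several bounds can later be taken at one common index.
  rational-between : ∀ {x y} → x ℝ.< y →
                     ∃[ N ] ∀ i → N ℕ.≤ i → ∃[ q ] x ≼ q × q < seq y i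
  rational-between {x} {y} (ε , 0<ε , N , x+ε≤y) =
    let N′ , h = cauchy x (½ * ε) (half-pos 0<ε) in
    N ℕ.⊔ N′ , λ i K≤i →
        let N≤i  = ℕ.m⊔n≤o⇒m≤o N N′ K≤i
            N′≤i = ℕ.m⊔n≤o⇒n≤o N N′ K≤i
        in seq x i + ½ * ε
         , (i , λ j i≤j → close⇒≤ (h j i (ℕ.≤-trans N′≤i i≤j) N′≤i))
         , <-≤-trans (+-monoʳ-< (seq x i) (half-< 0<ε)) (x+ε≤y i N≤i)

  -- Real `≤` is a negation: if the rational inequality failed, its gap would witness the reverse
  -- strict inequality of reals.
  cost-bound : ∀ {r α R a} t m → r ≼ R → α ≼ a → fromℕ t ℝ.≤ r ℝ.* fromℕ m ℝ.+ α →
               ι t ≤ R * ι m + a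
  cost-bound {r} {α} {R} {a} t m (N , r≤R) (N′ , α≤a) t≤ = ≮⇒≥ λ Rm+a<t → t≤
    (ι t - (R * ι m + a) , 0<q-p Rm+a<t , N ℕ.⊔ N′ , λ i K≤i → begin
      (seq r i * ι m + seq α i) + (ι t - (R * ι m + a))
        ≤⟨ +-monoˡ-≤ (ι t - (R * ι m + a)) (+-mono-≤
             (*-monoʳ-≤-nonNeg (ι m) {{nonNegative (0≤ι m)}} (r≤R i (ℕ.m⊔n≤o⇒m≤o N N′ K≤i)))
             (α≤a i (ℕ.m⊔n≤o⇒n≤o N N′ K≤i))) ⟩
      (R * ι m + a) + (ι t - (R * ι m + a))
        ≡⟨ solve 2 (λ b t → b :+ (t :- b) := t) refl (R * ι m + a) (ι t) ⟩
      ι t ∎)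
    where open ≤-Reasoning

  scale : ∀ {c a b} → 0ℚ ≤ c → a ≤ b → c * a ≤ c * b
  scale {c} 0≤c = *-monoˡ-≤-nonNeg c {{nonNegative 0≤c}}

  ⊔-<-lub : ∀ {a b c} → a < c → b < c → a ⊔ b < c
  ⊔-<-lub {a} {b} {c} a<c b<c with ⊔-sel a b
  ... | inj₁ eq = subst (_< c) (sym eq) a<c
  ... | inj₂ eq = subst (_< c) (sym eq) b<c

  -- The weighted cost inequality.

  module Tradeoff {L D R W a b : ℚ} (0≤L : 0ℚ ≤ L) (0<D : 0ℚ < D)
                  (R<E : R < 1ℚ + L * D) (WD<E : W * D < 1ℚ + L * D) where

    open ≤-Reasoning

    -- In use, `L` counts the nonzero colours, `R` and `W` bound the two ratios, and `a` and `b`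
    -- bound the additive constants. Including `0ℚ` in `M` makes multiplication by `M` preserve `≤`;
    -- `slack` gathers what does not grow with `n`.
    E M slack : ℚ
    E = 1ℚ + L * D
    M = R ⊔ W * D ⊔ 0ℚ
    slack = E * (1ℚ + L) + (a + L * (D * b))

    0≤LD : 0ℚ ≤ L * D
    0≤LD = subst (_≤ L * D) (*-zeroʳ L) (scale 0≤L (<⇒≤ 0<D))

    0<E : 0ℚ < E
    0<E = <-≤-trans (positive⁻¹ 1ℚ) (subst (_≤ E) (+-identityʳ 1ℚ) (+-monoʳ-≤ 1ℚ 0≤LD))

    M<E : M < E
    M<E = ⊔-<-lub (⊔-<-lub R<E WD<E) 0<E

    R≤M : R ≤ M
    R≤M = ≤-trans (p≤p⊔q R (W * D)) (p≤p⊔q (R ⊔ W * D) 0ℚ)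

    WD≤M : W * D ≤ M
    WD≤M = ≤-trans (p≤q⊔p R (W * D)) (p≤p⊔q (R ⊔ W * D) 0ℚ)

    0≤M : 0ℚ ≤ M
    0≤M = p≤q⊔p (R ⊔ W * D) 0ℚ

    split-cost : ∀ l d t → (1ℚ + l * d) * ((1ℚ + l) + t) ≡
                           (1ℚ + l * d) * (1ℚ + l) + (t + l * (d * t))
    split-cost = solve 3 (λ l d t → (con 1ℚ :+ l :* d) :* ((con 1ℚ :+ l) :+ t) :=
      (con 1ℚ :+ l :* d) :* (con 1ℚ :+ l) :+ (t :+ l :* (d :* t))) refl

    collect : ∀ e M c a l m d b →
      e + ((M * c + a) + l * (M * m + d * b)) ≡ M * (c + l * m) + (e + (a + l * (d * b)))
    collect = solve 8 (λ e M c a l m d b →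
      e :+ ((M :* c :+ a) :+ l :* (M :* m :+ d :* b)) :=
      M :* (c :+ l :* m) :+ (e :+ (a :+ l :* (d :* b)))) refl

    distribute : ∀ d w m b → d * (w * m + b) ≡ w * d * m + d * b
    distribute = solve 4 (λ d w m b → d :* (w :* m :+ b) := w :* d :* m :+ d :* b) refl

    -- The weight `E` on the cost `t` is split: weight one is charged to the predicted class `c`,
    -- weight `L * D` to the optimum `m`. The charges recombine into `M * (c + L * m)`.
    tradeoff : ∀ {n t c m} → 0ℚ ≤ c → 0ℚ ≤ m → n ≤ (1ℚ + L) + t → c + L * m ≤ n →
               t ≤ R * c + a → t ≤ W * m + b → E * n ≤ M * n + slack
    tradeoff {n} {t} {c} {m} 0≤c 0≤m n≤ ≤n t≤c t≤m = begin
      E * n                               ≤⟨ scale (<⇒≤ 0<E) n≤ ⟩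
      E * ((1ℚ + L) + t)                  ≡⟨ split-cost L D t ⟩
      E * (1ℚ + L) + (t + L * (D * t))
        ≤⟨ +-monoʳ-≤ (E * (1ℚ + L)) (+-mono-≤ t≤Mc (scale 0≤L Dt≤Mm)) ⟩
      E * (1ℚ + L) + ((M * c + a) + L * (M * m + D * b))
        ≡⟨ collect (E * (1ℚ + L)) M c a L m D b ⟩
      M * (c + L * m) + slack             ≤⟨ +-monoˡ-≤ slack (scale 0≤M ≤n) ⟩
      M * n + slack                       ∎
      where
      t≤Mc : t ≤ M * c + a
      t≤Mc = ≤-trans t≤c (+-monoˡ-≤ a (*-monoʳ-≤-nonNeg c {{nonNegative 0≤c}} R≤M))
      Dt≤Mm : D * t ≤ M * m + D * b
      Dt≤Mm = begin
        D * t               ≤⟨ scale (<⇒≤ 0<D) t≤m ⟩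
        D * (W * m + b)     ≡⟨ distribute D W m b ⟩
        W * D * m + D * b
          ≤⟨ +-monoˡ-≤ (D * b) (*-monoʳ-≤-nonNeg m {{nonNegative 0≤m}} WD≤M) ⟩
        M * m + D * b       ∎

    difference : ∀ x y n → x * n + (y - x) * n ≡ y * n
    difference = solve 3 (λ x y n → x :* n :+ (y :- x) :* n := y :* n) refl

    -- Since `E - M` is positive, its multiples outgrow `slack`.
    exceeded : ∃[ n ] M * ι n + slack < E * ι n
    exceeded =
      let n , slack< = archimedean-scaled (0<q-p M<E) slack in
      n , subst (M * ι n + slack <_) (difference M E (ι n)) (+-monoʳ-< (M * ι n) slack<)

  -- The two thresholds of the theorem.

  0<2-q : ∀ {q} → q < 1ℚ → 0ℚ < ι 2 - q
  0<2-q {q} q<1 = 0<q-p {q} {ι 2} (<-trans q<1 1<2)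
    where
    1<2 : 1ℚ < ι 2
    1<2 = *<* (ℤ.+<+ ℕ.≤-refl)

  -- After multiplication by the positive `2 - q`, the two sides differ by the square of `1 - q`.
  1-r≤1-q : ∀ {q} r → q < 1ℚ → r * (ι 2 - q) ≡ 1ℚ → 1ℚ - r ≤ 1ℚ - q
  1-r≤1-q {q} r q<1 r*[2-q]≡1 =
    *-cancelʳ-≤-pos (ι 2 - q) {{positive (0<2-q q<1)}} (begin
      (1ℚ - r) * (ι 2 - q)       ≡⟨ expand r q ⟩
      ι 2 - q - r * (ι 2 - q)    ≡⟨ cong (λ x → ι 2 - q - x) r*[2-q]≡1 ⟩
      ι 2 - q - 1ℚ               ≡⟨ simplify q ⟩
      (1ℚ - q) + 0ℚ              ≤⟨ +-monoʳ-≤ (1ℚ - q) (<⇒≤ (*-pos (0<q-p q<1) (0<q-p q<1))) ⟩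
      (1ℚ - q) + (1ℚ - q) * (1ℚ - q) ≡⟨ collect q ⟩
      (1ℚ - q) * (ι 2 - q)       ∎)
    where
    open ≤-Reasoning
    expand : ∀ r q → (1ℚ - r) * (ι 2 - q) ≡ ι 2 - q - r * (ι 2 - q)
    expand = solve 2 (λ r q → (con 1ℚ :- r) :* (con (ι 2) :- q) :=
      con (ι 2) :- q :- r :* (con (ι 2) :- q)) refl
    simplify : ∀ q → ι 2 - q - 1ℚ ≡ (1ℚ - q) + 0ℚ
    simplify = solve 1 (λ q → con (ι 2) :- q :- con 1ℚ := (con 1ℚ :- q) :+ con 0ℚ) refl
    collect : ∀ q → (1ℚ - q) + (1ℚ - q) * (1ℚ - q) ≡ (1ℚ - q) * (ι 2 - q)
    collect = solve 1 (λ q → (con 1ℚ :- q) :+ (con 1ℚ :- q) :* (con 1ℚ :- q) :=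
      (con 1ℚ :- q) :* (con (ι 2) :- q)) refl

  -- With `1 + l` the number of vertices of `H` and `r = 1/(2 - q)`, the left side equals
  -- `1 + l (1 - r)`.
  consistency-threshold : ∀ {l q} r → 0ℚ ≤ l → q < 1ℚ → r * (ι 2 - q) ≡ 1ℚ →
    (1ℚ + l) - r * ((1ℚ + l) - 1ℚ) ≤ 1ℚ + l * (1ℚ - q)
  consistency-threshold {l} {q} r 0≤l q<1 r*[2-q]≡1 =
    subst (_≤ 1ℚ + l * (1ℚ - q)) (sym (factor l r))
      (+-monoʳ-≤ 1ℚ (scale 0≤l (1-r≤1-q r q<1 r*[2-q]≡1)))
    where
    factor : ∀ l r → (1ℚ + l) - r * ((1ℚ + l) - 1ℚ) ≡ 1ℚ + l * (1ℚ - r)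
    factor = solve 2 (λ l r → (con 1ℚ :+ l) :- r :* ((con 1ℚ :+ l) :- con 1ℚ) :=
      con 1ℚ :+ l :* (con 1ℚ :- r)) refl

  -- Here `s = 1/(1 - q)`, so the factor `1 - q` turns `q * s` into `q`, which completes `1 - q` to
  -- one.
  robustness-threshold : ∀ l q s → s * (1ℚ - q) ≡ 1ℚ →
    ((1ℚ + l) + q * s) * (1ℚ - q) ≡ 1ℚ + l * (1ℚ - q)
  robustness-threshold l q s s*[1-q]≡1 = begin
    ((1ℚ + l) + q * s) * (1ℚ - q)                       ≡⟨ distribute l q s ⟩
    (1ℚ - q) + l * (1ℚ - q) + q * (s * (1ℚ - q))
      ≡⟨ cong (λ x → (1ℚ - q) + l * (1ℚ - q) + q * x) s*[1-q]≡1 ⟩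
    (1ℚ - q) + l * (1ℚ - q) + q * 1ℚ                    ≡⟨ cancel l q ⟩
    1ℚ + l * (1ℚ - q)                                   ∎
    where
    open ≡-Reasoning
    distribute : ∀ l q s → ((1ℚ + l) + q * s) * (1ℚ - q) ≡
                           (1ℚ - q) + l * (1ℚ - q) + q * (s * (1ℚ - q))
    distribute = solve 3 (λ l q s → ((con 1ℚ :+ l) :+ q :* s) :* (con 1ℚ :- q) :=
      (con 1ℚ :- q) :+ l :* (con 1ℚ :- q) :+ q :* (s :* (con 1ℚ :- q))) refl
    cancel : ∀ l q → (1ℚ - q) + l * (1ℚ - q) + q * 1ℚ ≡ 1ℚ + l * (1ℚ - q)
    cancel = solve 2 (λ l q → (con 1ℚ :- q) :+ l :* (con 1ℚ :- q) :+ q :* con 1ℚ :=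
      con 1ℚ :+ l :* (con 1ℚ :- q)) refl

open BlowUps
open RationalBounds
open import Data.Empty using (⊥)
open import Data.Fin.Subset using (∣_∣)
import Data.Nat as ℕ
import Data.Nat.Properties as ℕ
open import Data.Product using (_,_; proj₁; proj₂)
open import Data.Rational as ℚ using (1ℚ)
import Data.Rational.Properties as ℚ
open import Data.Sum using (inj₁; inj₂)
open import Data.Vec using (Vec)
open import Relation.Binary.PropositionalEquality using (_≡_; refl; sym; trans; cong; subst)

open import Defs
open import Data.Fin using (Fin; zero)
open import Data.Nat using (ℕ; suc) renaming (_<_ to _<ℕ_)
open import Data.Product using (Σ-syntax; ∃-syntax; _×_)
open import Data.Sum using (_⊎_)
open import Relation.Nullary using (¬_)

-- From a competitive algorithm to a contradiction.

module _ {k : ℕ} {H : Graph (Fin (suc k))} (rule : BlowUpRule H) (A : Algorithm H) where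

  open BlowUp rule
  open Game rule A
  open Run

  -- Consistency is applied to the padded game: padding keeps the size of class zero and can only
  -- raise the cost.
  prediction-cost : ∀ {r w R a n} → (comp : Competitive A r w) → r ≼ R → proj₁ comp ≼ a →
    (cs : Vec (Fin (suc k)) n) → ι ∣ response cs ∣ ℚ.≤ R ℚ.* ι ∣ class zero cs ∣ ℚ.+ a
  prediction-cost {r} {w} {n = n} (α , _ , comp) r≼R α≼a cs =
    ℚ.≤-trans (ι-mono-≤ {∣ response cs ∣} {∣ response (pad cs) ∣}
        (∣response∣-mono (padding (suc n)) cs))
      (cost-bound {r} {α} ∣ response (pad cs) ∣ ∣ class zero cs ∣ r≼R α≼a
        (bound ∣ class zero cs ∣ (pad-OPT cs)))
    where
    consistent = proj₁ (comp (blowUp (pad cs)))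
    bound : CostBound A (blowUp (pad cs)) (advice (pad cs)) r α
    -- Competitiveness supplies some correct advice; uniqueness of the minimum identifies it with
    -- the adversary's.
    bound = subst (λ u → CostBound A (blowUp (pad cs)) u r α)
      (strictly-smallest-class-unique (pad cs) zero (pad-class-zero-smallest cs)
        (proj₁ consistent) (proj₁ (proj₂ consistent)))
      (proj₂ (proj₂ consistent))

  -- Robustness covers every advice, so it applies to the unpadded game, whether or not class zero
  -- is optimal there.
  optimum-cost : ∀ {r w W b n} → (comp : Competitive A r w) → w ≼ W → proj₁ comp ≼ b →
    (g : Run n) → ι ∣ response (colours g) ∣ ℚ.≤ W ℚ.* ι (opt g) ℚ.+ b
  optimum-cost {w = w} (α , _ , comp) w≼W α≼b g =
    cost-bound {w} {α} ∣ response (colours g) ∣ (opt g) w≼W α≼b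
      (proj₂ (comp (blowUp (colours g))) (advice (colours g)) (opt g) (isOPT g))

  -- The two infima may be approached by different pairs of ratios, hence two competitiveness
  -- proofs, each with its own additive constant.
  rational-tradeoff : ∀ {r w r₀ w₀ R W D} → Competitive A r w₀ → Competitive A r₀ w →
    r ≼ R → w ≼ W → ℚ.0ℚ ℚ.< D →
    R ℚ.< 1ℚ ℚ.+ ι k ℚ.* D → W ℚ.* D ℚ.< 1ℚ ℚ.+ ι k ℚ.* D → ⊥
  rational-tradeoff {r} {w} {r₀} {w₀} {R} {W} {D} compR compW r≼R w≼W 0<D R<E WD<E =
    ℚ.<-irrefl refl (ℚ.<-≤-trans (proj₂ exceeded)
      (tradeoff {ι n} {ι t} {ι c} {ι (opt g)} (0≤ι c) (0≤ι (opt g)) n≤ ≤n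
        (prediction-cost {r} {w₀} compR r≼R (proj₂ a) (colours g))
        (optimum-cost {r₀} {w} compW w≼W (proj₂ b) g)))
    where
    a = bounded-above (proj₁ compR)
    b = bounded-above (proj₁ compW)
    open Tradeoff {ι k} {D} {R} {W} {proj₁ a} {proj₁ b} (0≤ι k) 0<D R<E WD<E
    -- The length depends on the constants only, so it is fixed before the game is played.
    n = proj₁ exceeded
    g : Run n
    g = run n
    c = ∣ class zero (colours g) ∣
    t = ∣ response (colours g) ∣
    n≤ : ι n ℚ.≤ (1ℚ ℚ.+ ι k) ℚ.+ ι t
    n≤ = subst (ι n ℚ.≤_) (trans (ι-+ (suc k) t) (cong (ℚ._+ ι t) (ι-+ 1 k)))
      (ι-mono-≤ {n} {suc k ℕ.+ t} (expense g))
    ≤n : ι c ℚ.+ ι k ℚ.* ι (opt g) ℚ.≤ ι n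
    ≤n = subst (ℚ._≤ ι n) (trans (ι-+ c (k ℕ.* opt g)) (cong (ι c ℚ.+_) (ι-* k (opt g))))
      (ι-mono-≤ {c ℕ.+ k ℕ.* opt g} {n} (classes g))

  tradeoff-bound : ∀ {p r w r₀ w₀} (p<1 : p < 1ℝ) →
    Competitive A r w₀ → Competitive A r₀ w →
    let 0<1-p = x<y⇒0<y-x {p} {1ℝ} p<1
        0<2-p = x<y⇒0<y-x {p} {2ℝ} (x<1⇒x<2 {p} p<1)
    in
    r < fromℕ (suc k) - 1/ (2ℝ - p) [ 0<2-p ] * (fromℕ (suc k) - 1ℝ) →
    w < fromℕ (suc k) + p * 1/ (1ℝ - p) [ 0<1-p ] → ⊥
  tradeoff-bound {p} {r} {w} {r₀} {w₀} p<1 compR compW r< w< =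
    rational-tradeoff {r} {w} {r₀} {w₀} {proj₁ R} {proj₁ W} {1ℚ ℚ.- q} compR compW
      (proj₁ (proj₂ R)) (proj₁ (proj₂ W)) (0<q-p q<1) R<E WD<E
    where
    Rˡ = fromℕ (suc k) -
      1/ (2ℝ - p) [ x<y⇒0<y-x {p} {2ℝ} (x<1⇒x<2 {p} p<1) ] * (fromℕ (suc k) - 1ℝ)
    Wˡ = fromℕ (suc k) + p * 1/ (1ℝ - p) [ x<y⇒0<y-x {p} {1ℝ} p<1 ]
    Nr = proj₁ (rational-between {r} {Rˡ} r<)
    Nw = proj₁ (rational-between {w} {Wˡ} w<)
    Np = proj₁ (eventually-< {p} {1ℝ} p<1)
    -- One index at which the bounds for `r`, `w` and `p` all hold.
    i = (Nr ℕ.⊔ Nw) ℕ.⊔ Np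
    Nr⊔Nw≤i : Nr ℕ.⊔ Nw ℕ.≤ i
    Nr⊔Nw≤i = ℕ.m≤m⊔n (Nr ℕ.⊔ Nw) Np
    R = proj₂ (rational-between {r} {Rˡ} r<) i (ℕ.≤-trans (ℕ.m≤m⊔n Nr Nw) Nr⊔Nw≤i)
    W = proj₂ (rational-between {w} {Wˡ} w<) i (ℕ.≤-trans (ℕ.m≤n⊔m Nr Nw) Nr⊔Nw≤i)
    -- Real operations act term by term, so at index `i` both thresholds are rational expressions in
    -- `q`.
    q = seq p i
    q<1 : q ℚ.< 1ℚ
    q<1 = proj₂ (eventually-< {p} {1ℝ} p<1) i (ℕ.m≤n⊔m (Nr ℕ.⊔ Nw) Np)
    ρ = recip (ι 2 ℚ.- q)
    σ = recip (1ℚ ℚ.- q)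
    R<E : proj₁ R ℚ.< 1ℚ ℚ.+ ι k ℚ.* (1ℚ ℚ.- q)
    R<E = ℚ.<-≤-trans (proj₂ (proj₂ R))
      (subst (λ x → x ℚ.- ρ ℚ.* (x ℚ.- 1ℚ) ℚ.≤ 1ℚ ℚ.+ ι k ℚ.* (1ℚ ℚ.- q)) (sym (ι-+ 1 k))
        (consistency-threshold ρ (0≤ι k) q<1 (recip-inverse (0<2-q q<1))))
    WD<E : proj₁ W ℚ.* (1ℚ ℚ.- q) ℚ.< 1ℚ ℚ.+ ι k ℚ.* (1ℚ ℚ.- q)
    WD<E = subst (proj₁ W ℚ.* (1ℚ ℚ.- q) ℚ.<_)
      (robustness-threshold (ι k) q σ (recip-inverse (0<q-p q<1)))
      (ℚ.*-monoˡ-<-pos (1ℚ ℚ.- q) {{ℚ.positive (0<q-p q<1)}}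
        (subst (λ x → proj₁ W ℚ.< x ℚ.+ q ℚ.* σ) (ι-+ 1 k) (proj₂ (proj₂ W))))

mainTheorem7 :
  (k : ℕ) → 1 <ℕ k → (H : Graph (Fin k)) → Connected H →
  (¬ (∃[ u ] ∃[ v ] TrueTwins H u v)) ⊎ (¬ (∃[ u ] ∃[ v ] FalseTwins H u v)) →
  (p : ℝ) → 0ℝ ≤ p → (p<1 : p < 1ℝ) →
  let 0<1-p = x<y⇒0<y-x {p} {1ℝ} p<1
      0<2-p = x<y⇒0<y-x {p} {2ℝ} (x<1⇒x<2 {p} p<1)
  in
  ¬ (Σ[ A ∈ Algorithm H ]
      (consistency A <ᵘ fromℕ k - 1/ (2ℝ - p) [ 0<2-p ] * (fromℕ k - 1ℝ)) ×
      (robustness A <ᵘ fromℕ k + p * 1/ (1ℝ - p) [ 0<1-p ]))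
mainTheorem7 (suc k) _ H _ twins p _ p<1
  (A , (r , (w₀ , compR) , r<) , (w , (r₀ , compW) , w<)) =
  tradeoff-bound (rule twins) A {p} {r} {w} {r₀} {w₀} p<1 compR compW r< w<
  where
  rule : (¬ (∃[ u ] ∃[ v ] TrueTwins H u v)) ⊎ (¬ (∃[ u ] ∃[ v ] FalseTwins H u v)) →
         BlowUpRule H
  rule (inj₁ ∄twins) = cliqueClasses H ∄twins
  rule (inj₂ ∄twins) = independentClasses H ∄twins
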